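{- For every integer $k \ge 1$, let $G_k$ be the cubic graph on $n = 8k$ vertices formed from $k$ disjoint copies $H_1,\dots,H_k$ of the graph $H$ (defined in the context) by adding the edges $h_i g_{i+1}$ for $i = 1,\dots,k$, with indices taken modulo $k$ (so $g_{k+1} = g_1$), where $g_i, h_i$ are the copies of the vertices $g,h$ in $H_i$. Then $\textrm{DET:IC\%}(G_k) = \frac{7}{8}$.
   Context: $H$ is the graph on the 8 vertices $a,b,c,d,e,f,g,h$ with the 11 edges $ga, ge, ca, ce, cd, db, df, hb, hf, ab, ef$ (equivalently, the 3-dimensional cube graph with the edge $gh$ removed); $g$ and $h$ have degree 2 in $H$ and all other vertices have degree 3. For a vertex $v$ of a graph $G$, $N[v]$ is its closed neighborhood, and for $S \subseteq V(G)$, $N_S[v] = N[v]\cap S$. A set $S \subseteq V(G)$ is an error-detecting identifying code (DET:IC) of $G$ if $|N_S[v]| \ge 2$ for every $v \in V(G)$, and for all distinct $u,v \in V(G)$, $|N_S[u] - N_S[v]| \ge 2$ or $|N_S[v] - N_S[u]| \ge 2$. For a finite graph $G$, $\textrm{DET:IC\%}(G)$ is the minimum of $|S|/|V(G)|$ over all DET:ICs $S$ of $G$. -}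

module Defs where

open import Data.Fin using (Fin; toℕ; remQuot)
open import Data.Fin.Patterns using (0F; 1F; 2F; 3F; 4F; 5F; 6F; 7F)
import Data.Fin.Properties as Fin
open import Data.Fin.Subset using (Subset; _∩_; _─_; ∣_∣)
open import Data.Integer using (+_)
open import Data.List using (List; []; _∷_)
open import Data.List.Membership.Propositional using (_∈_)
import Data.List.Membership.DecPropositional as DecMembership
open import Data.List.Relation.Unary.Any using (there)
open import Data.Nat using (ℕ; suc; _*_; _%_; _≥_; NonZero)
import Data.Nat.Properties as ℕ
open import Data.Product using (_×_; _,_; ∃-syntax)
open import Data.Product.Properties using (≡-dec)
open import Data.Rational using (ℚ; _≤_; _/_)
open import Data.Sum using (_⊎_; inj₁; inj₂)
import Data.Sum as Sum
open import Data.Vec using (tabulate)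
open import Level using (0ℓ)
open import Relation.Binary using (Rel; Symmetric; Irreflexive; Decidable)
open import Relation.Binary.PropositionalEquality using (_≡_; _≢_; refl)
open import Relation.Nullary using (¬_; does; _×-dec_; _⊎-dec_)

record Graph (n : ℕ) : Set₁ where
  field
    Adj    : Rel (Fin n) 0ℓ
    adj?   : Decidable Adj
    sym    : Symmetric Adj
    irrefl : Irreflexive _≡_ Adj

  N[_] : Fin n → Subset n
  N[ v ] = tabulate λ u → does ((u Fin.≟ v) ⊎-dec adj? v u)

  N⟨_⟩[_] : Subset n → Fin n → Subset n
  N⟨ S ⟩[ v ] = N[ v ] ∩ S

  record IsDETIC (S : Subset n) : Set where
    field
      dominates     : ∀ v → ∣ N⟨ S ⟩[ v ] ∣ ≥ 2
      distinguishes : ∀ u v → u ≢ v →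
        ∣ N⟨ S ⟩[ u ] ─ N⟨ S ⟩[ v ] ∣ ≥ 2 ⊎ ∣ N⟨ S ⟩[ v ] ─ N⟨ S ⟩[ u ] ∣ ≥ 2

density : ∀ {n} .{{_ : NonZero n}} → Subset n → ℚ
density {n} S = + ∣ S ∣ / n

IsMinimum : (ℚ → Set) → ℚ → Set
IsMinimum P q = P q × (∀ r → P r → q ≤ r)

-- The minimum is a relation rather than a function of G because a graph may
-- have no error-detecting identifying code at all.
DET:IC%[_]≡_ : ∀ {n} .{{_ : NonZero n}} → Graph n → ℚ → Set
DET:IC%[ G ]≡ q = IsMinimum (λ r → ∃[ S ] (Graph.IsDETIC G S × density S ≡ r)) q

pattern a = 0F
pattern b = 1F
pattern c = 2F
pattern d = 3F
pattern e = 4F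
pattern f = 5F
pattern g = 6F
pattern h = 7F

edgesH : List (Fin 8 × Fin 8)
edgesH = (g , a) ∷ (g , e) ∷ (c , a) ∷ (c , e) ∷ (c , d) ∷ (d , b) ∷
         (d , f) ∷ (h , b) ∷ (h , f) ∷ (a , b) ∷ (e , f) ∷ []

-- One orientation of each edge; (i , x) is the copy of x in Hᵢ, with the
-- copies indexed from 0.
Arc : ∀ k .{{_ : NonZero k}} → Rel (Fin k × Fin 8) 0ℓ
Arc k (i , x) (j , y) =
  (i ≡ j × (x , y) ∈ edgesH) ⊎ (x ≡ h × y ≡ g × toℕ j ≡ suc (toℕ i) % k)

Arc? : ∀ k .{{_ : NonZero k}} → Decidable (Arc k)
Arc? k (i , x) (j , y) =
  ((i Fin.≟ j) ×-dec ((x , y) ∈? edgesH)) ⊎-dec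
  ((x Fin.≟ h) ×-dec ((y Fin.≟ g) ×-dec (toℕ j ℕ.≟ suc (toℕ i) % k)))
  where open DecMembership (≡-dec (Fin._≟_ {8}) (Fin._≟_ {8})) using (_∈?_)

edgesH-loopless : ∀ x → ¬ (x , x) ∈ edgesH
edgesH-loopless x (there (there (there (there (there (there (there (there (there (there (there ())))))))))))

Arc-irrefl : ∀ k .{{_ : NonZero k}} p → ¬ Arc k p p
Arc-irrefl k (i , x) (inj₁ (_ , xx∈))        = edgesH-loopless x xx∈
Arc-irrefl k (i , x) (inj₂ (refl , () , _))

-- Vertex number 8i + x of G k stands for (i , x).
G : ∀ k .{{_ : NonZero k}} → Graph (k * 8)
G k = record
  { Adj    = λ u v → Arc k (vertex u) (vertex v) ⊎ Arc k (vertex v) (vertex u)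
  ; adj?   = λ u v → Arc? k (vertex u) (vertex v) ⊎-dec Arc? k (vertex v) (vertex u)
  ; sym    = Sum.swap
  ; irrefl = λ { {u} refl → λ { (inj₁ p) → Arc-irrefl k (vertex u) p
                              ; (inj₂ p) → Arc-irrefl k (vertex u) p } }
  }
  where
  vertex : Fin (k * 8) → Fin k × Fin 8
  vertex = remQuot 8

instance
  k*8≢0 : ∀ {k} .{{_ : NonZero k}} → NonZero (k * 8)
  k*8≢0 {k} = ℕ.m*n≢0 k 8

{-# OPTIONS --safe #-}

-- Adding the edge gh to H gives the cube Q₃ = G 1, and forgetting the copy
-- index is a covering map G k → Q₃; in particular it is injective on closed
-- neighbourhoods.  Since N_S[u] − N_S[v] = (N[u] − N[v]) ∩ S, codes are closed
-- under supersets, so for the lower bound it is enough that no two vertices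
-- of one copy are both missed: for each pair x ≠ y, some u ≠ v in the same
-- copy have at most one detector on either side once x and y are left out.
-- Conversely, missing exactly the vertex g of every copy gives a code, and two
-- detectors telling u from v can always be found in the copy of u or of v.
module Submission where

open import Defs
open import Data.Empty using (⊥)
open import Data.Fin using (Fin; zero; suc; toℕ; combine; remQuot)
import Data.Fin.Properties as Fin
open import Data.Fin.Subset
  using (Subset; inside; outside; _∈_; _∉_; _∩_; _∪_; _─_; _-_; ∁; ⊤; ⁅_⁆; ∣_∣; Nonempty)
open import Data.Fin.Subset.Properties
open import Data.Integer as ℤ using (+_)
import Data.Integer.Properties as ℤ
import Data.List.Membership.DecPropositional as DecMembership
open import Data.Nat using (ℕ; suc; _+_; _*_; _%_; _≤_; _<_; NonZero; z≤n; s≤s)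
open import Data.Nat.DivMod using (m<n⇒m%n≡m; n%n≡0)
import Data.Nat.Properties as ℕ
open import Data.Product using (_×_; _,_; proj₁; proj₂; ∃₂)
open import Data.Product.Properties using (≡-dec)
open import Data.Rational as ℚ using (_/_; toℚᵘ)
import Data.Rational.Properties as ℚ
open import Data.Rational.Unnormalised as ℚᵘ using (mkℚᵘ)
import Data.Rational.Unnormalised.Properties as ℚᵘ
open import Data.Sum as Sum using (_⊎_; inj₁; inj₂; [_,_]′)
open import Data.Vec using (Vec; []; _∷_; _++_; concat; group; lookup; replicate; there)
open import Data.Vec.Properties
  using (lookup∘tabulate; lookup⇒[]=; []=⇒lookup; lookup-concat; lookup-replicate)
open import Function using (_∘_; id)
open import Relation.Binary.PropositionalEquality
open import Relation.Nullary
  using (Dec; Reflects; does; proof; yes; no; invert; contradiction; ¬?; _×-dec_; _⊎-dec_; _→-dec_)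
open import Relation.Nullary.Decidable using (from-yes; dec-true)

private
  variable
    m n : ℕ

-- Subsets with at least two elements, and sizes of concatenations.

x∈p─q⇒x∉q : ∀ (p q : Subset n) {x} → x ∈ p ─ q → x ∉ q
x∈p─q⇒x∉q (_ ∷ p) (_ ∷ q) (there x∈p─q) (there x∈q) = x∈p─q⇒x∉q p q x∈p─q x∈q

x∈p-y⇒x≢y : ∀ (p : Subset n) {x y} → x ∈ p - y → x ≢ y
x∈p-y⇒x≢y p x∈p-x refl = x∈p─q⇒x∉q p ⁅ _ ⁆ x∈p-x (x∈⁅x⁆ _)

Nonempty⇒∣p∣≥1 : (p : Subset n) → Nonempty p → 1 ≤ ∣ p ∣
Nonempty⇒∣p∣≥1 p (_ , x∈p) = ℕ.≤-trans (s≤s z≤n) (x∈p⇒∣p-x∣<∣p∣ x∈p)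

∣p∣≥1⇒Nonempty : (p : Subset n) → 1 ≤ ∣ p ∣ → Nonempty p
∣p∣≥1⇒Nonempty {n} p 1≤∣p∣ with nonempty? p
... | yes ne = ne
... | no empty =
  contradiction (subst (1 ≤_) (trans (cong ∣_∣ (Empty-unique empty)) (∣⊥∣≡0 n)) 1≤∣p∣) λ ()

two⇒∣p∣≥2 : (p : Subset n) → ∀ {x y} → x ∈ p → y ∈ p → x ≢ y → 2 ≤ ∣ p ∣
two⇒∣p∣≥2 p {x} {y} x∈p y∈p x≢y =
  ℕ.≤-trans (s≤s (Nonempty⇒∣p∣≥1 (p - x) (y , x∈p∧x≢y⇒x∈p-y y∈p (x≢y ∘ sym))))
            (x∈p⇒∣p-x∣<∣p∣ x∈p)

∣p∣≥2⇒two : (p : Subset n) → 2 ≤ ∣ p ∣ → ∃₂ λ x y → x ∈ p × y ∈ p × x ≢ y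
∣p∣≥2⇒two p 2≤∣p∣ with ∣p∣≥1⇒Nonempty p (ℕ.≤-trans (s≤s z≤n) 2≤∣p∣)
... | x , x∈p with nonempty? (p - x)
...   | yes (y , y∈p-x) = x , y , x∈p , p─q⊆p p ⁅ x ⁆ y∈p-x ,
          x∈p-y⇒x≢y p y∈p-x ∘ sym
...   | no empty = contradiction (ℕ.≤-trans 2≤∣p∣ ∣p∣≤1) λ { (s≤s ()) }
  where
  p⊆⁅x⁆ : ∀ {y} → y ∈ p → y ∈ ⁅ x ⁆
  p⊆⁅x⁆ {y} y∈p with y Fin.≟ x
  ... | yes refl = x∈⁅x⁆ x
  ... | no y≢x   = contradiction (y , x∈p∧x≢y⇒x∈p-y y∈p y≢x) empty

  ∣p∣≤1 : ∣ p ∣ ≤ 1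
  ∣p∣≤1 = subst (∣ p ∣ ≤_) (∣⁅x⁆∣≡1 x) (p⊆q⇒∣p∣≤∣q∣ p⊆⁅x⁆)

-- Injectivity is asked on `p` alone because `label` is injective only on closed neighbourhoods; the
-- upper bound uses the embeddings `combine i` instead.
∣∣≥2-map : (φ : Fin m → Fin n) (p : Subset m) (q : Subset n) →
           (∀ {x y} → x ∈ p → y ∈ p → φ x ≡ φ y → x ≡ y) →
           (∀ {x} → x ∈ p → φ x ∈ q) → 2 ≤ ∣ p ∣ → 2 ≤ ∣ q ∣
∣∣≥2-map φ p q injective maps 2≤∣p∣ =
  let x , y , x∈p , y∈p , x≢y = ∣p∣≥2⇒two p 2≤∣p∣ in
  two⇒∣p∣≥2 q (maps x∈p) (maps y∈p) (x≢y ∘ injective x∈p y∈p)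

∣++∣ : (p : Subset m) (q : Subset n) → ∣ p ++ q ∣ ≡ ∣ p ∣ + ∣ q ∣
∣++∣ []            q = refl
∣++∣ (inside  ∷ p) q = cong suc (∣++∣ p q)
∣++∣ (outside ∷ p) q = ∣++∣ p q

∣concat-replicate∣ : ∀ k (p : Subset n) → ∣ concat (replicate k p) ∣ ≡ k * ∣ p ∣
∣concat-replicate∣ 0       p = refl
∣concat-replicate∣ (suc k) p =
  trans (∣++∣ p _) (cong (λ t → ∣ p ∣ + t) (∣concat-replicate∣ k p))

∣concat∣≥ : ∀ {k} t (ps : Vec (Subset n) k) → (∀ i → t ≤ ∣ lookup ps i ∣) →
            k * t ≤ ∣ concat ps ∣
∣concat∣≥ t []       t≤ = z≤n
∣concat∣≥ t (p ∷ ps) t≤ = subst (λ t′ → t + _ ≤ t′) (sym (∣++∣ p (concat ps)))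
  (ℕ.+-mono-≤ (t≤ zero) (∣concat∣≥ t ps (t≤ ∘ suc)))

-- Cyclic successor and comparison of fractions.

suc%-injective : ∀ {k i j} .{{_ : NonZero k}} → i < k → j < k →
                 suc i % k ≡ suc j % k → i ≡ j
suc%-injective {k} {i} {j} i<k j<k eq with ℕ.m≤n⇒m<n∨m≡n i<k | ℕ.m≤n⇒m<n∨m≡n j<k
... | inj₁ si<k | inj₁ sj<k =
  ℕ.suc-injective (trans (sym (m<n⇒m%n≡m si<k)) (trans eq (m<n⇒m%n≡m sj<k)))
-- Only the last residue wraps around, and it wraps to 0, which is no successor.
... | inj₁ si<k | inj₂ refl =
  contradiction (trans (sym (m<n⇒m%n≡m si<k)) (trans eq (n%n≡0 k))) λ ()
... | inj₂ refl | inj₁ sj<k =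
  contradiction (trans (sym (m<n⇒m%n≡m sj<k)) (trans (sym eq) (n%n≡0 k))) λ ()
... | inj₂ refl | inj₂ refl = refl

-- `_/_` reduces to lowest terms, so the comparison is made among unnormalised rationals, where the
-- order is cross-multiplication by definition.
/-mono-≤ : ∀ s t m n .{{_ : NonZero m}} .{{_ : NonZero n}} →
           s * n ≤ t * m → + s / m ℚ.≤ + t / n
/-mono-≤ s t m@(suc m-1) n@(suc n-1) sn≤tm = ℚ.toℚᵘ-cancel-≤ (begin
  toℚᵘ (+ s / m)    ≃⟨ ℚ.toℚᵘ-fromℚᵘ (mkℚᵘ (+ s) m-1) ⟩
  mkℚᵘ (+ s) m-1    ≤⟨ ℚᵘ.*≤* (subst₂ ℤ._≤_ (ℤ.pos-* s n) (ℤ.pos-* t m) (ℤ.+≤+ sn≤tm)) ⟩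
  mkℚᵘ (+ t) n-1    ≃⟨ ℚ.toℚᵘ-fromℚᵘ (mkℚᵘ (+ t) n-1) ⟨
  toℚᵘ (+ t / n)    ∎)
  where open ℚᵘ.≤-Reasoning

-- Closed neighbourhoods in an arbitrary graph.

module _ (Γ : Graph n) where
  open Graph Γ using (Adj; adj?; N[_]; N⟨_⟩[_])

  ∈N⁺ : ∀ {u v} → u ≡ v ⊎ Adj v u → u ∈ N[ v ]
  ∈N⁺ {u} {v} adj = lookup⇒[]= u _
    (trans (lookup∘tabulate _ u) (dec-true ((u Fin.≟ v) ⊎-dec adj? v u) adj))

  ∈N⁻ : ∀ {u v} → u ∈ N[ v ] → u ≡ v ⊎ Adj v u
  ∈N⁻ {u} {v} u∈N = invert (subst (Reflects _)
    (trans (sym (lookup∘tabulate (does ∘ adj-or-equal) u)) ([]=⇒lookup u∈N))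
    (proof (adj-or-equal u)))
    where
    adj-or-equal : ∀ w → Dec (w ≡ v ⊎ Adj v w)
    adj-or-equal w = (w Fin.≟ v) ⊎-dec adj? v w

  ∈N─N⁺ : ∀ S u v {w} → w ∈ N[ u ] → w ∉ N[ v ] → w ∈ S → w ∈ N⟨ S ⟩[ u ] ─ N⟨ S ⟩[ v ]
  ∈N─N⁺ S u v w∈Nu w∉Nv w∈S =
    x∈p∧x∉q⇒x∈p─q (x∈p∩q⁺ (w∈Nu , w∈S)) (w∉Nv ∘ proj₁ ∘ x∈p∩q⁻ N[ v ] S)

  ∈N─N⁻ : ∀ S u v {w} → w ∈ N⟨ S ⟩[ u ] ─ N⟨ S ⟩[ v ] → w ∈ N[ u ] × w ∉ N[ v ] × w ∈ S
  ∈N─N⁻ S u v w∈ =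
    let w∈Nu , w∈S = x∈p∩q⁻ N[ u ] S (p─q⊆p N⟨ S ⟩[ u ] N⟨ S ⟩[ v ] w∈)
    in w∈Nu ,
       (λ w∈Nv → x∈p─q⇒x∉q N⟨ S ⟩[ u ] N⟨ S ⟩[ v ] w∈ (x∈p∩q⁺ (w∈Nv , w∈S))) ,
       w∈S

-- Finite checks on `H` and the cube `G 1`.

H : Graph 8
H = record
  { Adj    = λ x y → (x , y) ∈ₗ edgesH ⊎ (y , x) ∈ₗ edgesH
  ; adj?   = λ x y → ((x , y) ∈ₗ? edgesH) ⊎-dec ((y , x) ∈ₗ? edgesH)
  ; sym    = Sum.swap
  ; irrefl = λ { {x} refl → [ edgesH-loopless x , edgesH-loopless x ]′ }
  }
  where
  open DecMembership (≡-dec (Fin._≟_ {8}) (Fin._≟_ {8}))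
    using () renaming (_∈_ to _∈ₗ_; _∈?_ to _∈ₗ?_)

open Graph using (IsDETIC)
open Graph H using () renaming (N[_] to NH[_])
open Graph (G 1) using () renaming (N[_] to NQ[_])

-- Bounds the labels of the detectors in N[ u ] but not in N[ v ] when the
-- vertices x and y of the copy of u and v are missed; the neighbour of u in
-- another copy, labelled by NQ[ u ] ─ NH[ u ], always counts.
difference : (x y u v : Fin 8) → Subset 8
difference x y u v = NQ[ u ] ─ (NH[ u ] ∩ (NH[ v ] ∪ (⁅ x ⁆ ∪ ⁅ y ⁆)))

-- Abstract, so that uses of these facts never unfold the exhaustive checks.
abstract
  NH⊆NQ : ∀ y {x} → x ∈ NH[ y ] → x ∈ NQ[ y ]
  NH⊆NQ = from-yes (Fin.all? λ y → NH[ y ] ⊆? NQ[ y ])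

  -- In the cube, closed neighbourhoods of distinct vertices at distance at most 2 differ by exactly
  -- two vertices each way, so it suffices to have `x` in one difference and `y` in the other. The
  -- search finds such `u`, `v` not affected by the removal of the edge gh.
  missing-pair : ∀ x y → x ≢ y → ∃₂ λ u v → u ≢ v ×
    ∣ difference x y u v ∣ ≤ 1 × ∣ difference x y v u ∣ ≤ 1
  missing-pair = from-yes (Fin.all? λ x → Fin.all? λ y → ¬? (x Fin.≟ y) →-dec
    Fin.any? λ u → Fin.any? λ v → ¬? (u Fin.≟ v) ×-dec
    ((∣ difference x y u v ∣ ℕ.≤? 1) ×-dec (∣ difference x y v u ∣ ℕ.≤? 1)))

  -- A vertex of another copy can be adjacent to g and h only.
  two-private : ∀ x → 2 ≤ ∣ NH[ x ] - g - h ∣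
  two-private = from-yes (Fin.all? λ x → 2 ℕ.≤? ∣ NH[ x ] - g - h ∣)

  -- Subtracting the larger `NQ` rather than `NH` also covers k = 1, where the link joins h to g of
  -- the same copy.
  two-separating : ∀ x y → x ≢ y →
    2 ≤ ∣ NH[ x ] - g ─ NQ[ y ] ∣ ⊎ 2 ≤ ∣ NH[ y ] - g ─ NQ[ x ] ∣
  two-separating = from-yes (Fin.all? λ x → Fin.all? λ y → ¬? (x Fin.≟ y) →-dec
    ((2 ℕ.≤? ∣ NH[ x ] - g ─ NQ[ y ] ∣) ⊎-dec (2 ℕ.≤? ∣ NH[ y ] - g ─ NQ[ x ] ∣)))

private-witness : ∀ x {w} → w ∈ NH[ x ] - g - h → w ∈ NH[ x ] × w ≢ g × w ≢ h
private-witness x w∈ =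
  let w∈N-g = p─q⊆p (NH[ x ] - g) ⁅ h ⁆ w∈ in
  p─q⊆p NH[ x ] ⁅ g ⁆ w∈N-g , x∈p-y⇒x≢y NH[ x ] w∈N-g , x∈p-y⇒x≢y (NH[ x ] - g) w∈

-- The covering map `label` from `G k` to the cube.

module _ (k : ℕ) .{{_ : NonZero k}} where
  open Graph (G k) using (Adj; N[_]; N⟨_⟩[_])

  label : Fin (k * 8) → Fin 8
  label = proj₂ ∘ remQuot {k} 8

  label-combine : ∀ (i : Fin k) x → label (combine i x) ≡ x
  label-combine i x = cong proj₂ (Fin.remQuot-combine i x)

  Adj-combine : ∀ (i j : Fin k) x y → Adj (combine i x) (combine j y) ≡
                (Arc k (i , x) (j , y) ⊎ Arc k (j , y) (i , x))
  Adj-combine i j x y = cong₂ (λ p q → Arc k p q ⊎ Arc k q p)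
    (Fin.remQuot-combine i x) (Fin.remQuot-combine j y)

  NH⊆N : ∀ (i : Fin k) y {x} → x ∈ NH[ y ] → combine i x ∈ N[ combine i y ]
  NH⊆N i y {x} x∈N with ∈N⁻ H x∈N
  ... | inj₁ x≡y = ∈N⁺ (G k) (inj₁ (cong (combine i) x≡y))
  ... | inj₂ adj = ∈N⁺ (G k) (inj₂ (subst id (sym (Adj-combine i i y x))
                     (Sum.map (λ e → inj₁ (refl , e)) (λ e → inj₁ (refl , e)) adj)))

  Link : Fin k × Fin 8 → Fin k × Fin 8 → Set
  Link (i , x) (j , y) = x ≡ h × y ≡ g × toℕ j ≡ suc (toℕ i) % k

  -- The link cases do not exclude `j ≡ i`: for k = 1 a copy is linked to itself.
  N-combine : ∀ (i j : Fin k) x y → combine j x ∈ N[ combine i y ] →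
    (j ≡ i × x ∈ NH[ y ]) ⊎ (Link (i , y) (j , x) ⊎ Link (j , x) (i , y))
  N-combine i j x y x∈N with ∈N⁻ (G k) x∈N
  ... | inj₁ eq with refl , refl ← Fin.combine-injective j x i y eq =
    inj₁ (refl , ∈N⁺ H (inj₁ refl))
  ... | inj₂ adj with subst id (Adj-combine i j y x) adj
  ...   | inj₁ (inj₁ (refl , yx)) = inj₁ (refl , ∈N⁺ H (inj₂ (inj₁ yx)))
  ...   | inj₁ (inj₂ link)        = inj₂ (inj₁ link)
  ...   | inj₂ (inj₁ (refl , xy)) = inj₁ (refl , ∈N⁺ H (inj₂ (inj₂ xy)))
  ...   | inj₂ (inj₂ link)        = inj₂ (inj₂ link)

  N-combine-label : ∀ (i j : Fin k) x y → combine j x ∈ N[ combine i y ] → x ∈ NQ[ y ]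
  N-combine-label i j x y x∈N with N-combine i j x y x∈N
  ... | inj₁ (_ , x∈NH)               = NH⊆NQ y x∈NH
  ... | inj₂ (inj₁ (refl , refl , _)) = from-yes (g ∈? NQ[ h ])
  ... | inj₂ (inj₂ (refl , refl , _)) = from-yes (h ∈? NQ[ g ])

  -- Links join labels g and h only, and these are not adjacent in `H`.
  N-combine-copy : ∀ (i j : Fin k) x y → combine j x ∈ N[ combine i y ] → x ∈ NH[ y ] → j ≡ i
  N-combine-copy i j x y x∈N x∈NH with N-combine i j x y x∈N
  ... | inj₁ (j≡i , _)                = j≡i
  ... | inj₂ (inj₁ (refl , refl , _)) = contradiction x∈NH (from-yes (¬? (g ∈? NH[ h ])))
  ... | inj₂ (inj₂ (refl , refl , _)) = contradiction x∈NH (from-yes (¬? (h ∈? NH[ g ])))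

  -- If one of the two vertices is a neighbour within the copy, `N-combine-copy` puts the other
  -- there too. Otherwise both are reached by links, whose direction is fixed by the labels, and
  -- each copy has one successor and one predecessor.
  label-injective-N : ∀ (i : Fin k) y {p q} → p ∈ N[ combine i y ] → q ∈ N[ combine i y ] →
                      label p ≡ label q → p ≡ q
  label-injective-N i y {p} {q} p∈N q∈N eq
    with j , x , refl ← Fin.combine-surjective {k} {8} p
       | j′ , x′ , refl ← Fin.combine-surjective {k} {8} q
    with refl ← trans (sym (label-combine j x)) (trans eq (label-combine j′ x′))
    = cong (λ t → combine t x) (same-copy (N-combine i j x y p∈N) (N-combine i j′ x y q∈N))
    where
    same-copy : (j ≡ i × x ∈ NH[ y ]) ⊎ (Link (i , y) (j , x) ⊎ Link (j , x) (i , y)) →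
                (j′ ≡ i × x ∈ NH[ y ]) ⊎ (Link (i , y) (j′ , x) ⊎ Link (j′ , x) (i , y)) →
                j ≡ j′
    same-copy (inj₁ (j≡i , x∈NH)) _ = trans j≡i (sym (N-combine-copy i j′ x y q∈N x∈NH))
    same-copy _ (inj₁ (j′≡i , x∈NH)) = trans (N-combine-copy i j x y p∈N x∈NH) (sym j′≡i)
    same-copy (inj₂ (inj₁ (_ , _ , next))) (inj₂ (inj₁ (_ , _ , next′))) =
      Fin.toℕ-injective (trans next (sym next′))
    same-copy (inj₂ (inj₂ (_ , _ , prev))) (inj₂ (inj₂ (_ , _ , prev′))) =
      Fin.toℕ-injective (suc%-injective (Fin.toℕ<n j) (Fin.toℕ<n j′) (trans (sym prev) prev′))
    same-copy (inj₂ (inj₁ (refl , _ , _))) (inj₂ (inj₂ (_ , () , _)))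
    same-copy (inj₂ (inj₂ (_ , refl , _))) (inj₂ (inj₁ (() , _ , _)))

  -- Lower bound: each copy misses at most one vertex.

  module _ {S : Subset (k * 8)} where

    difference-bound : ∀ (i : Fin k) x y u v → combine i x ∉ S → combine i y ∉ S →
      2 ≤ ∣ N⟨ S ⟩[ combine i u ] ─ N⟨ S ⟩[ combine i v ] ∣ → 2 ≤ ∣ difference x y u v ∣
    difference-bound i x y u v x∉S y∉S = ∣∣≥2-map label _ _
      (λ p∈ q∈ → label-injective-N i u (proj₁ (split p∈)) (proj₁ (split q∈)))
      (λ {p} p∈ → maps (Fin.combine-surjective {k} {8} p) p∈)
      where
      split : ∀ {p} → p ∈ N⟨ S ⟩[ combine i u ] ─ N⟨ S ⟩[ combine i v ] →
              p ∈ N[ combine i u ] × p ∉ N[ combine i v ] × p ∈ S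
      split = ∈N─N⁻ (G k) S (combine i u) (combine i v)

      maps : ∀ {p} → ∃₂ (λ j w → combine j w ≡ p) →
             p ∈ N⟨ S ⟩[ combine i u ] ─ N⟨ S ⟩[ combine i v ] → label p ∈ difference x y u v
      maps (j , w , refl) p∈ with p∈Nu , p∉Nv , p∈S ← split p∈ =
        subst (_∈ difference x y u v) (sym (label-combine j w))
          (x∈p∧x∉q⇒x∈p─q (N-combine-label i j w u p∈Nu) w∉)
        where
        w∉ : w ∉ NH[ u ] ∩ (NH[ v ] ∪ (⁅ x ⁆ ∪ ⁅ y ⁆))
        w∉ w∈ with w∈Nu , w∈X ← x∈p∩q⁻ NH[ u ] _ w∈
          -- A label in `NH[ u ]` belongs to copy `i` itself, so lying in `NH[ v ]` or being `x` or
          -- `y` contradicts the choice of the detector.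
          with refl ← N-combine-copy i j w u p∈Nu w∈Nu
          with x∈p∪q⁻ NH[ v ] _ w∈X
        ... | inj₁ w∈Nv = p∉Nv (NH⊆N i v w∈Nv)
        ... | inj₂ w∈xy with x∈p∪q⁻ ⁅ x ⁆ ⁅ y ⁆ w∈xy
        ...   | inj₁ w∈x with refl ← x∈⁅y⁆⇒x≡y x w∈x = x∉S p∈S
        ...   | inj₂ w∈y with refl ← x∈⁅y⁆⇒x≡y y w∈y = y∉S p∈S

    not-both-missing : IsDETIC (G k) S → ∀ (i : Fin k) x y → x ≢ y →
                       combine i x ∉ S → combine i y ∉ S → ⊥
    not-both-missing isDETIC i x y x≢y x∉S y∉S =
      let u , v , u≢v , uv≤1 , vu≤1 = missing-pair x y x≢y in
      [ ℕ.≤⇒≯ uv≤1 ∘ difference-bound i x y u v x∉S y∉S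
      , ℕ.≤⇒≯ vu≤1 ∘ difference-bound i x y v u x∉S y∉S
      ]′ (IsDETIC.distinguishes isDETIC (combine i u) (combine i v)
            (u≢v ∘ Fin.combine-injectiveʳ i u i v))

  ∣S∣≥7k : ∀ S → IsDETIC (G k) S → k * 7 ≤ ∣ S ∣
  ∣S∣≥7k S isDETIC with ps , refl ← group k 8 S = ∣concat∣≥ 7 ps λ i → ℕ.≮⇒≥ λ ∣p∣<7 →
    let p = lookup ps i
        lift : ∀ x → x ∈ ∁ p → combine i x ∉ concat ps
        lift x x∈∁p x∈S = x∈∁p⇒x∉p x∈∁p (lookup⇒[]= x p
          (trans (sym (lookup-concat ps i x)) ([]=⇒lookup x∈S)))
        -- At most 6 detectors among the 8 vertices of the copy leave two vertices missed.
        x , y , x∈ , y∈ , x≢y = ∣p∣≥2⇒two (∁ p) (subst (2 ≤_) (sym (∣∁p∣≡n∸∣p∣ p))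
          (ℕ.∸-monoʳ-≤ 8 (ℕ.≤-pred ∣p∣<7)))
    in not-both-missing isDETIC i x y x≢y (lift x x∈) (lift y y∈)

  -- Upper bound: the code missing every g.

  code : Subset (k * 8)
  code = concat (replicate k (⊤ - g))

  combine∈code : ∀ (i : Fin k) x → x ≢ g → combine i x ∈ code
  combine∈code i x x≢g = lookup⇒[]= (combine i x) code
    (trans (lookup-concat (replicate k (⊤ - g)) i x)
    (trans (cong (λ p → lookup p x) (lookup-replicate i (⊤ - g)))
           ([]=⇒lookup (x∈p∧x≢y⇒x∈p-y ∈⊤ x≢g))))

  ∣∣≥2-combine : ∀ (i : Fin k) (p : Subset 8) (q : Subset (k * 8)) →
                 (∀ {x} → x ∈ p → combine i x ∈ q) → 2 ≤ ∣ p ∣ → 2 ≤ ∣ q ∣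
  ∣∣≥2-combine i p q = ∣∣≥2-map (combine i) p q (λ _ _ → Fin.combine-injectiveʳ i _ i _)

  code-same-copy : ∀ (i : Fin k) x y → 2 ≤ ∣ NH[ x ] - g ─ NQ[ y ] ∣ →
    2 ≤ ∣ N⟨ code ⟩[ combine i x ] ─ N⟨ code ⟩[ combine i y ] ∣
  code-same-copy i x y = ∣∣≥2-combine i (NH[ x ] - g ─ NQ[ y ])
    (N⟨ code ⟩[ combine i x ] ─ N⟨ code ⟩[ combine i y ]) λ {w} w∈ →
    let w∈N-g = p─q⊆p (NH[ x ] - g) NQ[ y ] w∈ in
    ∈N─N⁺ (G k) code (combine i x) (combine i y)
      (NH⊆N i x (p─q⊆p NH[ x ] ⁅ g ⁆ w∈N-g))
      (x∈p─q⇒x∉q (NH[ x ] - g) NQ[ y ] w∈ ∘ N-combine-label i i w y)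
      (combine∈code i w (x∈p-y⇒x≢y NH[ x ] w∈N-g))

  code-other-copy : ∀ (i j : Fin k) x y → i ≢ j →
    2 ≤ ∣ N⟨ code ⟩[ combine i x ] ─ N⟨ code ⟩[ combine j y ] ∣
  code-other-copy i j x y i≢j = ∣∣≥2-combine i (NH[ x ] - g - h)
    (N⟨ code ⟩[ combine i x ] ─ N⟨ code ⟩[ combine j y ]) (λ {w} w∈ →
    let w∈N , w≢g , w≢h = private-witness x w∈ in
    ∈N─N⁺ (G k) code (combine i x) (combine j y) (NH⊆N i x w∈N)
      -- Being near a vertex of another copy would take a link, making `w` g or h.
      ([ i≢j ∘ proj₁ , [ w≢g ∘ proj₁ ∘ proj₂ , w≢h ∘ proj₁ ]′ ]′ ∘ N-combine j i w y)
      (combine∈code i w w≢g)) (two-private x)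

  code-isDETIC : IsDETIC (G k) code
  code-isDETIC = record { dominates = dominates ; distinguishes = distinguishes }
    where
    dominates : ∀ v → 2 ≤ ∣ N⟨ code ⟩[ v ] ∣
    dominates v with i , x , refl ← Fin.combine-surjective {k} {8} v =
      ∣∣≥2-combine i (NH[ x ] - g - h) N⟨ code ⟩[ combine i x ] (λ {w} w∈ →
        let w∈N , w≢g , _ = private-witness x w∈ in
        x∈p∩q⁺ (NH⊆N i x w∈N , combine∈code i w w≢g)) (two-private x)

    distinguishes : ∀ u v → u ≢ v → 2 ≤ ∣ N⟨ code ⟩[ u ] ─ N⟨ code ⟩[ v ] ∣ ⊎
                                   2 ≤ ∣ N⟨ code ⟩[ v ] ─ N⟨ code ⟩[ u ] ∣
    distinguishes u v u≢v
      with i , x , refl ← Fin.combine-surjective {k} {8} u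
         | j , y , refl ← Fin.combine-surjective {k} {8} v
      with i Fin.≟ j
    ... | no i≢j   = inj₁ (code-other-copy i j x y i≢j)
    ... | yes refl = Sum.map (code-same-copy i x y) (code-same-copy i y x)
                       (two-separating x y (u≢v ∘ cong (combine i)))

theorem4p2 : (k : ℕ) .{{_ : NonZero k}} → DET:IC%[ G k ]≡ (+ 7 / 8)
theorem4p2 k =
  -- The density equals 7/8 by cross-multiplying in both directions.
  (code k , code-isDETIC k , ℚ.≤-antisym
    (/-mono-≤ ∣ code k ∣ 7 (k * 8) 8 (ℕ.≤-reflexive (trans (cong (_* 8) ∣code∣) (k7*8 k))))
    (/-mono-≤ 7 ∣ code k ∣ 8 (k * 8) (ℕ.≤-reflexive (sym (trans (cong (_* 8) ∣code∣) (k7*8 k)))))) ,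
  λ { _ (S , isDETIC , refl) → /-mono-≤ 7 ∣ S ∣ 8 (k * 8)
        (ℕ.≤-trans (ℕ.≤-reflexive (sym (k7*8 k))) (ℕ.*-monoˡ-≤ 8 (∣S∣≥7k k S isDETIC))) }
  where
  ∣code∣ : ∣ code k ∣ ≡ k * 7
  ∣code∣ = ∣concat-replicate∣ k (⊤ - g)

  k7*8 : ∀ k → k * 7 * 8 ≡ 7 * (k * 8)
  k7*8 k = trans (cong (_* 8) (ℕ.*-comm k 7)) (ℕ.*-assoc 7 k 8)
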